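{- There exists a non-trivial model of dependent type theory with a cumulative hierarchy of universes in the style of Agda, in which, for every level $\ell$, every type $A : \mathcal{U}_\ell$ and every function $f : \mathcal{U}_\ell \to A$, the function $f$ is constant, i.e.\ for all $X, Y : \mathcal{U}_\ell$ the interpretation satisfies $f\,X = f\,Y$.
   Context: Dependent type theory (DTT) here means Martin-Löf-style type theory with dependent function types $(x : A) \to B(x)$ and a hierarchy of universes $\mathcal{U}_\ell$ indexed by levels $\ell \in \mathbb{N}$, where $\mathcal{U}_\ell : \mathcal{U}_{\ell+1}$. "Agda-style cumulativity" means that cumulativity is not implicit subtyping but is given by a lifting operation: for every $X : \mathcal{U}_\ell$ there is a type $\mathrm{Lift}\,X : \mathcal{U}_{\ell+1}$ together with an isomorphism $\mathrm{Lift}\,X \cong X$. A model is non-trivial if it does not identify all terms/types (in particular it is not the model in which every type is a singleton; e.g.\ some type is uninhabited). A function $f : \mathcal{U}_\ell \to A$ is constant if $f\,X$ and $f\,Y$ are equal for all $X, Y : \mathcal{U}_\ell$. Note that the hypothesis $A : \mathcal{U}_\ell$ excludes e.g.\ $A = \mathcal{U}_\ell$ (which lives in $\mathcal{U}_{\ell+1}$), for which the identity function would be a non-constant example. -}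

module Defs where

open import Agda.Primitive using (Setω)
open import Data.Nat.Base using (ℕ; zero; suc; _⊔_)
open import Data.Product.Base using (Σ-syntax; _×_)
open import Level as L using (Level)
open import Relation.Binary.Core using (Rel)
open import Relation.Binary.Structures using (IsEquivalence)
open import Relation.Nullary.Negation.Core using (¬_)

-- Categories with families in which every type carries a universe level,
-- with Π-types, universes and lifting.  Judgemental equality is interpreted
-- by equivalence relations, since there are no quotient types here.
--
-- Terms of types A and B over the same context are compared by a single
-- relation _≈ᵗ_, which can hold only if A ≈ᵀ B; `coe` moves a term to an
-- equal type without changing it up to _≈ᵗ_.  Thus equations such as
-- t [ id ]ᵗ ≈ᵗ t need no explicit transport.

record CwF (c s t m e : Level) : Set (L.suc (c L.⊔ s L.⊔ t L.⊔ m L.⊔ e)) where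
  infix  4 _≈ˢ_ _≈ᵀ_ _≈ᵗ_
  infixr 9 _∘_
  infixl 8 _[_]ᵀ _[_]ᵗ
  infixl 5 _▷_

  field
    Con  : Set c
    Sub  : Con → Con → Set s
    _≈ˢ_ : ∀ {Δ Γ} → Rel (Sub Δ Γ) e
    ≈ˢ-isEquivalence : ∀ {Δ Γ} → IsEquivalence (_≈ˢ_ {Δ} {Γ})

    id    : ∀ {Γ} → Sub Γ Γ
    _∘_   : ∀ {Θ Δ Γ} → Sub Δ Γ → Sub Θ Δ → Sub Θ Γ
    ∘-cong : ∀ {Θ Δ Γ} {σ σ′ : Sub Δ Γ} {τ τ′ : Sub Θ Δ} →
             σ ≈ˢ σ′ → τ ≈ˢ τ′ → σ ∘ τ ≈ˢ σ′ ∘ τ′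
    ∘-assoc : ∀ {Ξ Θ Δ Γ} (σ : Sub Δ Γ) (τ : Sub Θ Δ) (ρ : Sub Ξ Θ) →
              (σ ∘ τ) ∘ ρ ≈ˢ σ ∘ (τ ∘ ρ)
    ∘-identityˡ : ∀ {Δ Γ} (σ : Sub Δ Γ) → id ∘ σ ≈ˢ σ
    ∘-identityʳ : ∀ {Δ Γ} (σ : Sub Δ Γ) → σ ∘ id ≈ˢ σ

    ◇ : Con
    ! : ∀ {Γ} → Sub Γ ◇
    !-unique : ∀ {Γ} (σ : Sub Γ ◇) → σ ≈ˢ !

    Ty   : Con → ℕ → Set t
    _≈ᵀ_ : ∀ {Γ ℓ} → Rel (Ty Γ ℓ) e
    ≈ᵀ-isEquivalence : ∀ {Γ ℓ} → IsEquivalence (_≈ᵀ_ {Γ} {ℓ})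
    _[_]ᵀ : ∀ {Δ Γ ℓ} → Ty Γ ℓ → Sub Δ Γ → Ty Δ ℓ
    []ᵀ-cong : ∀ {Δ Γ ℓ} {A A′ : Ty Γ ℓ} {σ σ′ : Sub Δ Γ} →
               A ≈ᵀ A′ → σ ≈ˢ σ′ → A [ σ ]ᵀ ≈ᵀ A′ [ σ′ ]ᵀ
    []ᵀ-id : ∀ {Γ ℓ} (A : Ty Γ ℓ) → A [ id ]ᵀ ≈ᵀ A
    []ᵀ-∘  : ∀ {Θ Δ Γ ℓ} (A : Ty Γ ℓ) (σ : Sub Δ Γ) (τ : Sub Θ Δ) →
             A [ σ ∘ τ ]ᵀ ≈ᵀ A [ σ ]ᵀ [ τ ]ᵀ

    Tm   : ∀ Γ {ℓ} → Ty Γ ℓ → Set m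
    _≈ᵗ_ : ∀ {Γ ℓ} {A B : Ty Γ ℓ} → Tm Γ A → Tm Γ B → Set e
    ≈ᵗ-refl  : ∀ {Γ ℓ} {A : Ty Γ ℓ} {a : Tm Γ A} → a ≈ᵗ a
    ≈ᵗ-sym   : ∀ {Γ ℓ} {A B : Ty Γ ℓ} {a : Tm Γ A} {b : Tm Γ B} →
               a ≈ᵗ b → b ≈ᵗ a
    ≈ᵗ-trans : ∀ {Γ ℓ} {A B C : Ty Γ ℓ}
               {a : Tm Γ A} {b : Tm Γ B} {c : Tm Γ C} →
               a ≈ᵗ b → b ≈ᵗ c → a ≈ᵗ c
    ≈ᵗ⇒≈ᵀ    : ∀ {Γ ℓ} {A B : Ty Γ ℓ} {a : Tm Γ A} {b : Tm Γ B} →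
               a ≈ᵗ b → A ≈ᵀ B
    coe   : ∀ {Γ ℓ} {A B : Ty Γ ℓ} → A ≈ᵀ B → Tm Γ A → Tm Γ B
    coe-≈ : ∀ {Γ ℓ} {A B : Ty Γ ℓ} (A≈B : A ≈ᵀ B) (a : Tm Γ A) →
            coe A≈B a ≈ᵗ a
    _[_]ᵗ : ∀ {Δ Γ ℓ} {A : Ty Γ ℓ} →
            Tm Γ A → (σ : Sub Δ Γ) → Tm Δ (A [ σ ]ᵀ)
    []ᵗ-cong : ∀ {Δ Γ ℓ} {A A′ : Ty Γ ℓ} {a : Tm Γ A} {a′ : Tm Γ A′}
               {σ σ′ : Sub Δ Γ} →
               a ≈ᵗ a′ → σ ≈ˢ σ′ → a [ σ ]ᵗ ≈ᵗ a′ [ σ′ ]ᵗ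
    []ᵗ-id : ∀ {Γ ℓ} {A : Ty Γ ℓ} (a : Tm Γ A) → a [ id ]ᵗ ≈ᵗ a
    []ᵗ-∘  : ∀ {Θ Δ Γ ℓ} {A : Ty Γ ℓ} (a : Tm Γ A)
             (σ : Sub Δ Γ) (τ : Sub Θ Δ) →
             a [ σ ∘ τ ]ᵗ ≈ᵗ a [ σ ]ᵗ [ τ ]ᵗ

    _▷_   : ∀ Γ {ℓ} → Ty Γ ℓ → Con
    p     : ∀ {Γ ℓ} {A : Ty Γ ℓ} → Sub (Γ ▷ A) Γ
    q     : ∀ {Γ ℓ} {A : Ty Γ ℓ} → Tm (Γ ▷ A) (A [ p ]ᵀ)
    ⟨_,_⟩ : ∀ {Δ Γ ℓ} {A : Ty Γ ℓ} (σ : Sub Δ Γ) →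
            Tm Δ (A [ σ ]ᵀ) → Sub Δ (Γ ▷ A)
    p-⟨⟩  : ∀ {Δ Γ ℓ} {A : Ty Γ ℓ} (σ : Sub Δ Γ) (a : Tm Δ (A [ σ ]ᵀ)) →
            p {A = A} ∘ ⟨ σ , a ⟩ ≈ˢ σ
    q-⟨⟩  : ∀ {Δ Γ ℓ} {A : Ty Γ ℓ} (σ : Sub Δ Γ) (a : Tm Δ (A [ σ ]ᵀ)) →
            q {A = A} [ ⟨ σ , a ⟩ ]ᵗ ≈ᵗ a
    ⟨⟩-unique : ∀ {Δ Γ ℓ} {A : Ty Γ ℓ} {σ : Sub Δ Γ} {a : Tm Δ (A [ σ ]ᵀ)}
                (ρ : Sub Δ (Γ ▷ A)) →
                p ∘ ρ ≈ˢ σ → q [ ρ ]ᵗ ≈ᵗ a → ρ ≈ˢ ⟨ σ , a ⟩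

  -- The canonical isomorphism between extensions by equal types.
  ▷-coe : ∀ {Γ ℓ} {A A′ : Ty Γ ℓ} → A ≈ᵀ A′ → Sub (Γ ▷ A) (Γ ▷ A′)
  ▷-coe A≈A′ =
    ⟨ p , coe ([]ᵀ-cong A≈A′ (IsEquivalence.refl ≈ˢ-isEquivalence)) q ⟩

  _↑_ : ∀ {Δ Γ ℓ} (σ : Sub Δ Γ) (A : Ty Γ ℓ) → Sub (Δ ▷ A [ σ ]ᵀ) (Γ ▷ A)
  σ ↑ A =
    ⟨ σ ∘ p , coe (IsEquivalence.sym ≈ᵀ-isEquivalence ([]ᵀ-∘ A σ p)) q ⟩

  inst : ∀ {Γ ℓ} {A : Ty Γ ℓ} → Tm Γ A → Sub Γ (Γ ▷ A)
  inst {A = A} a =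
    ⟨ id , coe (IsEquivalence.sym ≈ᵀ-isEquivalence ([]ᵀ-id A)) a ⟩

-- As in Agda, the level of a Π-type is the maximum of the levels of its
-- domain and codomain.

record HasΠ {c s t m e} (C : CwF c s t m e)
            : Set (c L.⊔ s L.⊔ t L.⊔ m L.⊔ e) where
  open CwF C
  infixr 6 _⇒_
  infixl 7 _·_

  field
    Π : ∀ {Γ i j} (A : Ty Γ i) → Ty (Γ ▷ A) j → Ty Γ (i ⊔ j)
    Π-cong : ∀ {Γ i j} {A A′ : Ty Γ i}
             {B : Ty (Γ ▷ A) j} {B′ : Ty (Γ ▷ A′) j}
             (A≈A′ : A ≈ᵀ A′) → B ≈ᵀ B′ [ ▷-coe A≈A′ ]ᵀ →
             Π A B ≈ᵀ Π A′ B′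
    Π-[] : ∀ {Δ Γ i j} (A : Ty Γ i) (B : Ty (Γ ▷ A) j) (σ : Sub Δ Γ) →
           Π A B [ σ ]ᵀ ≈ᵀ Π (A [ σ ]ᵀ) (B [ σ ↑ A ]ᵀ)

    lam : ∀ {Γ i j} {A : Ty Γ i} {B : Ty (Γ ▷ A) j} →
          Tm (Γ ▷ A) B → Tm Γ (Π A B)
    lam-cong : ∀ {Γ i j} {A A′ : Ty Γ i}
               {B : Ty (Γ ▷ A) j} {B′ : Ty (Γ ▷ A′) j}
               {b : Tm (Γ ▷ A) B} {b′ : Tm (Γ ▷ A′) B′}
               (A≈A′ : A ≈ᵀ A′) → b ≈ᵗ b′ [ ▷-coe A≈A′ ]ᵗ →
               lam b ≈ᵗ lam b′
    lam-[] : ∀ {Δ Γ i j} {A : Ty Γ i} {B : Ty (Γ ▷ A) j}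
             (b : Tm (Γ ▷ A) B) (σ : Sub Δ Γ) →
             lam b [ σ ]ᵗ ≈ᵗ lam (b [ σ ↑ A ]ᵗ)

    app : ∀ {Γ i j} {A : Ty Γ i} {B : Ty (Γ ▷ A) j} →
          Tm Γ (Π A B) → Tm (Γ ▷ A) B
    app-cong : ∀ {Γ i j} {A A′ : Ty Γ i}
               {B : Ty (Γ ▷ A) j} {B′ : Ty (Γ ▷ A′) j}
               {f : Tm Γ (Π A B)} {f′ : Tm Γ (Π A′ B′)}
               (A≈A′ : A ≈ᵀ A′) → B ≈ᵀ B′ [ ▷-coe A≈A′ ]ᵀ →
               f ≈ᵗ f′ → app f ≈ᵗ app f′ [ ▷-coe A≈A′ ]ᵗ

    Π-β : ∀ {Γ i j} {A : Ty Γ i} {B : Ty (Γ ▷ A) j} (b : Tm (Γ ▷ A) B) →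
          app (lam b) ≈ᵗ b
    Π-η : ∀ {Γ i j} {A : Ty Γ i} {B : Ty (Γ ▷ A) j} (f : Tm Γ (Π A B)) →
          lam (app f) ≈ᵗ f

  _⇒_ : ∀ {Γ i j} → Ty Γ i → Ty Γ j → Ty Γ (i ⊔ j)
  A ⇒ B = Π A (B [ p ]ᵀ)

  _·_ : ∀ {Γ i j} {A : Ty Γ i} {B : Ty (Γ ▷ A) j} →
        Tm Γ (Π A B) → (a : Tm Γ A) → Tm Γ (B [ inst a ]ᵀ)
  f · a = app f [ inst a ]ᵗ

-- The terms of U ℓ are exactly the types of level ℓ, up to equality, so
-- each universe is closed under all type formers of the model.
-- Stability of `code` under substitution follows from the other laws.

record HasUniverses {c s t m e} (C : CwF c s t m e)
                    : Set (c L.⊔ s L.⊔ t L.⊔ m L.⊔ e) where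
  open CwF C

  field
    U    : ∀ {Γ} ℓ → Ty Γ (suc ℓ)
    U-[] : ∀ {Δ Γ} ℓ (σ : Sub Δ Γ) → U ℓ [ σ ]ᵀ ≈ᵀ U ℓ

    El      : ∀ {Γ ℓ} → Tm Γ (U ℓ) → Ty Γ ℓ
    El-cong : ∀ {Γ ℓ} {X Y : Tm Γ (U ℓ)} → X ≈ᵗ Y → El X ≈ᵀ El Y
    El-[]   : ∀ {Δ Γ ℓ} (X : Tm Γ (U ℓ)) (σ : Sub Δ Γ) →
              El X [ σ ]ᵀ ≈ᵀ El (coe (U-[] ℓ σ) (X [ σ ]ᵗ))

    code      : ∀ {Γ ℓ} → Ty Γ ℓ → Tm Γ (U ℓ)
    code-cong : ∀ {Γ ℓ} {A B : Ty Γ ℓ} → A ≈ᵀ B → code A ≈ᵗ code B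

    El-code : ∀ {Γ ℓ} (A : Ty Γ ℓ) → El (code A) ≈ᵀ A
    code-El : ∀ {Γ ℓ} (X : Tm Γ (U ℓ)) → code (El X) ≈ᵗ X

-- Stability of `lower` under substitution follows from that of `lift`.

record HasLift {c s t m e} (C : CwF c s t m e)
               : Set (c L.⊔ s L.⊔ t L.⊔ m L.⊔ e) where
  open CwF C

  field
    Lift      : ∀ {Γ ℓ} → Ty Γ ℓ → Ty Γ (suc ℓ)
    Lift-cong : ∀ {Γ ℓ} {A B : Ty Γ ℓ} → A ≈ᵀ B → Lift A ≈ᵀ Lift B
    Lift-[]   : ∀ {Δ Γ ℓ} (A : Ty Γ ℓ) (σ : Sub Δ Γ) →
                Lift A [ σ ]ᵀ ≈ᵀ Lift (A [ σ ]ᵀ)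

    lift      : ∀ {Γ ℓ} {A : Ty Γ ℓ} → Tm Γ A → Tm Γ (Lift A)
    lift-cong : ∀ {Γ ℓ} {A B : Ty Γ ℓ} {a : Tm Γ A} {b : Tm Γ B} →
                a ≈ᵗ b → lift a ≈ᵗ lift b
    lift-[]   : ∀ {Δ Γ ℓ} {A : Ty Γ ℓ} (a : Tm Γ A) (σ : Sub Δ Γ) →
                lift a [ σ ]ᵗ ≈ᵗ lift (a [ σ ]ᵗ)

    lower      : ∀ {Γ ℓ} {A : Ty Γ ℓ} → Tm Γ (Lift A) → Tm Γ A
    lower-cong : ∀ {Γ ℓ} {A B : Ty Γ ℓ}
                 {a : Tm Γ (Lift A)} {b : Tm Γ (Lift B)} →
                 A ≈ᵀ B → a ≈ᵗ b → lower a ≈ᵗ lower b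

    lower-lift : ∀ {Γ ℓ} {A : Ty Γ ℓ} (a : Tm Γ A) → lower (lift a) ≈ᵗ a
    lift-lower : ∀ {Γ ℓ} {A : Ty Γ ℓ} (a : Tm Γ (Lift A)) →
                 lift (lower a) ≈ᵗ a

record Model (c s t m e : Level) : Set (L.suc (c L.⊔ s L.⊔ t L.⊔ m L.⊔ e)) where
  field
    cwf          : CwF c s t m e
    hasΠ         : HasΠ cwf
    hasUniverses : HasUniverses cwf
    hasLift      : HasLift cwf

  open CwF cwf public
  open HasΠ hasΠ public
  open HasUniverses hasUniverses public
  open HasLift hasLift public

-- Both witnesses are required in the lowest universe; by lifting there are
-- then such types at every level, so that no universe is degenerate.

NonTrivial : ∀ {c s t m e} → Model c s t m e → Set (t L.⊔ m L.⊔ e)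
NonTrivial M =
  (Σ[ A ∈ Ty ◇ zero ] ¬ Tm ◇ A) ×
  (Σ[ B ∈ Ty ◇ zero ] Σ[ a ∈ Tm ◇ B ] Σ[ b ∈ Tm ◇ B ] ¬ (a ≈ᵗ b))
  where open Model M

-- Γ is arbitrary, so f may be open and X and Y may in particular be variables.

module _ {c s t m e} (M : Model c s t m e) where
  open Model M

  IsConstant : ∀ {Γ : Con} {ℓ : ℕ} (A : Tm Γ (U ℓ)) →
               Tm Γ (U ℓ ⇒ El A) → Set (m L.⊔ e)
  IsConstant {Γ} {ℓ} A f = (X Y : Tm Γ (U ℓ)) → f · X ≈ᵗ f · Y

-- The sizes of the components of the model are existentially quantified too.
record ∃Model (P : ∀ {c s t m e} → Model c s t m e → Set (c L.⊔ t L.⊔ m L.⊔ e))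
              : Setω where
  constructor exhibit
  field
    {c s t m e} : Level
    model       : Model c s t m e
    property    : P model

{-# OPTIONS --safe #-}
module Submission where

-- A setoid model in which every code also carries heterogeneous relations
-- Rel k, defined by recursion on pairs of codes, for k a natural number or ∞.
-- Rel ∞ is equality; functions have to preserve every Rel k.  On the universe
-- of level n, Rel k is equality of codes for n < k and total for k ≤ n.  By
-- induction on codes, Rel k coincides with equality on each single type of
-- level at most k.  So f : U ℓ → A sends any X and Y, which are related by
-- Rel ℓ, to elements of A related by Rel ℓ, that is, to equal elements.

open import Data.Nat.Base using (ℕ; zero; suc; _⊔_; _<_; _≤_; _≤′_; ≤′-reflexive; ≤′-step)
open import Data.Nat.Properties using
  (≤-refl; ≤-trans; <-irrefl; n≤1+n; ≤⇒≤′; m≤m⊔n; m≤n⊔m; ≤-<-trans)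
open import Data.Bool.Base using (Bool; true; false)
open import Data.Empty using (⊥; ⊥-elim)
open import Data.Product.Base using (Σ; _×_; _,_; proj₁; proj₂)
open import Data.Unit.Base using (⊤; tt)
open import Function.Base using (case_of_)
open import Relation.Binary.PropositionalEquality.Core using (_≡_; refl; sym; trans)
open import Defs

-- Relations on codes

data Index : Set where
  fin : ℕ → Index
  ∞   : Index

_≺_ : ℕ → Index → Set
n ≺ fin k = n < k
n ≺ ∞     = ⊤

≤-≺-trans : ∀ {m n} k → m ≤ n → n ≺ k → m ≺ k
≤-≺-trans (fin k) = ≤-<-trans
≤-≺-trans ∞       = λ _ _ → tt

record Universe : Set₁ where
  field
    Code : Set
    El   : Code → Set
    Eq   : Code → Code → Set
    -- The two codes need not be equal: a dependent function applied to arguments related only at a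
    -- finite index takes values in codes that may differ.
    Rel  : Index → (X Y : Code) → El X → El Y → Set

    eq-refl  : ∀ X → Eq X X
    eq-sym   : ∀ X Y → Eq X Y → Eq Y X
    eq-trans : ∀ X Y Z → Eq X Y → Eq Y Z → Eq X Z
    rel-refl : ∀ k X x → Rel k X X x x
    -- One law in place of symmetry and transitivity: together with `rel-refl` it yields both for
    -- `Rel ∞` between equal codes.
    rel-resp : ∀ k X X′ Y Y′ → Eq X X′ → Eq Y Y′ → ∀ x x′ y y′ →
               Rel ∞ X X′ x x′ → Rel ∞ Y Y′ y y′ →
               Rel k X Y x y → Rel k X′ Y′ x′ y′
    cast     : ∀ X Y → Eq X Y → El X → El Y
    cast-rel : ∀ X Y (e : Eq X Y) x → Rel ∞ X Y x (cast X Y e x)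

  rel-sym : ∀ X Y → Eq X Y → ∀ x y → Rel ∞ X Y x y → Rel ∞ Y X y x
  rel-sym X Y e x y r =
    rel-resp ∞ X Y X X e (eq-refl X) x y x x r (rel-refl ∞ X x) (rel-refl ∞ X x)

  rel-respˡ : ∀ k X Y Z → Eq X Y → ∀ x y z →
              Rel ∞ X Y x y → Rel k X Z x z → Rel k Y Z y z
  rel-respˡ k X Y Z e x y z r s =
    rel-resp k X Y Z Z e (eq-refl Z) x y z z r (rel-refl ∞ Z z) s

  rel-respʳ : ∀ k X Y Z → Eq Y Z → ∀ x y z →
              Rel ∞ Y Z y z → Rel k X Y x y → Rel k X Z x z
  rel-respʳ k X Y Z e x y z r s =
    rel-resp k X X Y Z (eq-refl X) e x x y z (rel-refl ∞ X x) r s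

  ∞⇒rel : ∀ k X Y → Eq X Y → ∀ x y → Rel ∞ X Y x y → Rel k X Y x y
  ∞⇒rel k X Y e x y r = rel-respʳ k X X Y e x x y r (rel-refl k X x)

  Discrete : Index → Set
  Discrete k = ∀ X Y → Eq X Y → ∀ x y → Rel k X Y x y → Rel ∞ X Y x y

-- Closing a universe under Π-types

module Closure (P : Universe) where
  private module P = Universe P

  -- Induction-recursion: a Π-code has to mention the equality on its own domain. Families respect
  -- only `Rel ∞`, because the tautological family over a universe is not constant along the lower
  -- indices; functions preserve every `Rel k`.
  data Code : Set
  El  : Code → Set
  Eq  : Code → Code → Set
  Rel : Index → (X Y : Code) → El X → El Y → Set

  data Code where
    base : P.Code → Code
    π    : (A : Code) (B : El A → Code) →
           (∀ a a′ → Rel ∞ A A a a′ → Eq (B a) (B a′)) → Code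

  El (base X)  = P.El X
  El (π A B _) = Σ ((a : El A) → El (B a)) λ f →
    ∀ k a a′ → Rel k A A a a′ → Rel k (B a) (B a′) (f a) (f a′)

  Eq (base X)  (base Y)    = P.Eq X Y
  Eq (π A B _) (π A′ B′ _) =
    Eq A A′ × (∀ a a′ → Rel ∞ A A′ a a′ → Eq (B a) (B′ a′))
  Eq _         _           = ⊥

  Rel k (base X)  (base Y)    x y = P.Rel k X Y x y
  Rel k (π A B _) (π A′ B′ _) f g =
    ∀ a a′ → Rel k A A′ a a′ → Rel k (B a) (B′ a′) (proj₁ f a) (proj₁ g a′)
  Rel k (base _)  (π _ _ _)   _ _ = ⊥
  Rel k (π _ _ _) (base _)    _ _ = ⊥

  eq-refl : ∀ X → Eq X X
  eq-refl (base X)   = P.eq-refl X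
  eq-refl (π A B B-eq) = eq-refl A , B-eq

  rel-refl : ∀ k X x → Rel k X X x x
  rel-refl k (base X)  x       = P.rel-refl k X x
  rel-refl k (π A B _) (f , f-rel) = f-rel k

  -- These five are proved together: for Π-codes, each comparison moves arguments between equal
  -- domains by `cast`, and `cast-rel` says that this does not change them.
  eq-sym   : ∀ X Y → Eq X Y → Eq Y X
  eq-trans : ∀ X Y Z → Eq X Y → Eq Y Z → Eq X Z
  rel-resp : ∀ k X X′ Y Y′ → Eq X X′ → Eq Y Y′ → ∀ x x′ y y′ →
             Rel ∞ X X′ x x′ → Rel ∞ Y Y′ y y′ →
             Rel k X Y x y → Rel k X′ Y′ x′ y′
  cast     : ∀ X Y → Eq X Y → El X → El Y
  cast-rel : ∀ X Y (e : Eq X Y) x → Rel ∞ X Y x (cast X Y e x)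

  private
    rel-sym : ∀ X Y → Eq X Y → ∀ x y → Rel ∞ X Y x y → Rel ∞ Y X y x
    rel-sym X Y e x y r =
      rel-resp ∞ X Y X X e (eq-refl X) x y x x r (rel-refl ∞ X x) (rel-refl ∞ X x)

    rel-transʳ : ∀ k X Y Z → Eq Y Z → ∀ x y z →
                 Rel k X Y x y → Rel ∞ Y Z y z → Rel k X Z x z
    rel-transʳ k X Y Z e x y z r s =
      rel-resp k X X Y Z (eq-refl X) e x x y z (rel-refl ∞ X x) s r

  eq-sym (base X) (base Y) e = P.eq-sym X Y e
  eq-sym (π A B _) (π A′ B′ _) (e , h) = eq-sym A A′ e , λ a′ a r →
    eq-sym (B a) (B′ a′) (h a a′ (rel-sym A′ A (eq-sym A A′ e) a′ a r))

  eq-trans (base X) (base Y) (base Z) d e = P.eq-trans X Y Z d e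
  eq-trans (π A B _) (π A′ B′ _) (π A″ B″ _) (d , h) (e , i) =
    eq-trans A A′ A″ d e , λ a c r →
      -- To compose `h` with `i`, an argument in the middle domain is needed; the cast of `a`
      -- serves, and it is related to `c` because `a` is.
      let b = cast A A′ d a
          s = cast-rel A A′ d a
      in eq-trans (B a) (B′ b) (B″ c) (h a b s)
           (i b c (rel-resp ∞ A A′ A″ A″ d (eq-refl A″) a b c c
                    s (rel-refl ∞ A″ c) r))

  rel-resp k (base X) (base X′) (base Y) (base Y′) = P.rel-resp k X X′ Y Y′
  rel-resp k (base _) (base _) (π _ _ _) (π _ _ _) _ _ _ _ _ _ _ _ ()
  rel-resp k (π _ _ _) (π _ _ _) (base _) (base _) _ _ _ _ _ _ _ _ ()
  rel-resp k (π A B _) (π A′ B′ _) (π C D _) (π C′ D′ _)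
    (d , h) (e , i) (f , _) (f′ , _) (g , _) (g′ , _) s t r a′ c′ q =
    -- The given arguments lie in the primed domains. Casting them back lets `r` apply, and the
    -- recursive call carries the result to the primed codomains.
    let d⁻ = eq-sym A A′ d
        e⁻ = eq-sym C C′ e
        a  = cast A′ A d⁻ a′
        c  = cast C′ C e⁻ c′
        a′a = cast-rel A′ A d⁻ a′
        c′c = cast-rel C′ C e⁻ c′
        aa′ = rel-sym A′ A d⁻ a′ a a′a
        cc′ = rel-sym C′ C e⁻ c′ c c′c
    in rel-resp k (B a) (B′ a′) (D c) (D′ c′) (h a a′ aa′) (i c c′ cc′)
         (f a) (f′ a′) (g c) (g′ c′) (s a a′ aa′) (t c c′ cc′)
         (r a c (rel-resp k A′ A C′ C d⁻ e⁻ a′ a c′ c a′a c′c q))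

  cast (base X) (base Y) e = P.cast X Y e
  cast (π A B _) (π A′ B′ _) (e , h) (f , f-rel) =
    (λ a′ → cast (B (to a′)) (B′ a′) (B≈ a′) (f (to a′))) ,
    λ k a′ c′ r → rel-resp k (B (to a′)) (B′ a′) (B (to c′)) (B′ c′)
      (B≈ a′) (B≈ c′) (f (to a′)) _ (f (to c′)) _
      (cast-rel (B (to a′)) (B′ a′) (B≈ a′) (f (to a′)))
      (cast-rel (B (to c′)) (B′ c′) (B≈ c′) (f (to c′)))
      (f-rel k (to a′) (to c′)
        (rel-resp k A′ A A′ A e⁻ e⁻ a′ (to a′) c′ (to c′)
          (cast-rel A′ A e⁻ a′) (cast-rel A′ A e⁻ c′) r))
    where
    e⁻ = eq-sym A A′ e
    to : El A′ → El A
    to = cast A′ A e⁻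
    B≈ : ∀ a′ → Eq (B (to a′)) (B′ a′)
    B≈ a′ = h (to a′) a′ (rel-sym A′ A e⁻ a′ (to a′) (cast-rel A′ A e⁻ a′))

  cast-rel (base X) (base Y) e x = P.cast-rel X Y e x
  cast-rel (π A B _) (π A′ B′ _) (e , h) (f , f-rel) a a′ r =
    rel-transʳ ∞ (B a) (B c) (B′ a′) B≈ _ _ _
      (f-rel ∞ a c (rel-transʳ ∞ A A′ A e⁻ a a′ c r (cast-rel A′ A e⁻ a′)))
      (cast-rel (B c) (B′ a′) B≈ (f c))
    where
    e⁻ = eq-sym A A′ e
    c  = cast A′ A e⁻ a′
    B≈ : Eq (B c) (B′ a′)
    B≈ = h c a′ (rel-sym A′ A e⁻ a′ c (cast-rel A′ A e⁻ a′))

  closure : Universe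
  closure = record
    { Code = Code ; El = El ; Eq = Eq ; Rel = Rel
    ; eq-refl = eq-refl ; eq-sym = eq-sym ; eq-trans = eq-trans
    ; rel-refl = rel-refl ; rel-resp = rel-resp
    ; cast = cast ; cast-rel = cast-rel
    }

  private module C = Universe closure

  -- The induction follows codomains: arguments related at ∞ are also related at `k`, so `r` relates
  -- the values at `k`, and these values lie in equal codes.
  closure-discrete : ∀ k → P.Discrete k → C.Discrete k
  closure-discrete k d (base X) (base Y) e x y r = d X Y e x y r
  closure-discrete k d (π A B _) (π A′ B′ _) (e , h) (f , _) (g , _) r a a′ s =
    closure-discrete k d (B a) (B′ a′) (h a a′ s) (f a) (g a′)
      (r a a′ (C.∞⇒rel k A A′ e a a′ s))

open Closure using (base; π; closure; closure-discrete)

-- The cumulative hierarchy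

data GroundCode : Set where
  empty bool : GroundCode

module Ground where
  El : GroundCode → Set
  El empty = ⊥
  El bool  = Bool

  Rel : (X Y : GroundCode) → El X → El Y → Set
  Rel bool bool x y = x ≡ y
  Rel _    _    _ _ = ⊥

  rel-refl : ∀ X x → Rel X X x x
  rel-refl bool x = refl

  rel-resp : ∀ X X′ Y Y′ → X ≡ X′ → Y ≡ Y′ → ∀ x x′ y y′ →
             Rel X X′ x x′ → Rel Y Y′ y y′ → Rel X Y x y → Rel X′ Y′ x′ y′
  rel-resp bool _ bool _ refl refl x x′ y y′ r s t = trans (sym r) (trans t s)

  cast : ∀ X Y → X ≡ Y → El X → El Y
  cast _ _ refl x = x

  cast-rel : ∀ X Y (e : X ≡ Y) x → Rel X Y x (cast X Y e x)
  cast-rel X _ refl x = rel-refl X x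

  ground : Universe
  ground = record
    { Code = GroundCode ; El = El ; Eq = _≡_ ; Rel = λ _ → Rel
    ; eq-refl = λ _ → refl ; eq-sym = λ _ _ → sym ; eq-trans = λ _ _ _ → trans
    ; rel-refl = λ _ → rel-refl ; rel-resp = λ _ → rel-resp
    ; cast = cast ; cast-rel = cast-rel
    }

open Ground using (ground)

-- `raise` wraps whole codes of the level below, so a raised Π-code differs from the Π-code of the
-- raised parts: lifting is an isomorphism on elements and does not commute strictly with Π.
data SucCode (C : Set) : Set where
  uni   : SucCode C
  raise : C → SucCode C

module Successor (n : ℕ) (P : Universe) where
  private module P = Universe P

  El : SucCode P.Code → Set
  El uni       = P.Code
  El (raise X) = P.El X

  Eq : (X Y : SucCode P.Code) → Set
  Eq uni       uni       = ⊤
  Eq (raise X) (raise Y) = P.Eq X Y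
  Eq _         _         = ⊥

  Rel : Index → (X Y : SucCode P.Code) → El X → El Y → Set
  Rel k uni       uni       X Y = n ≺ k → P.Eq X Y
  Rel k (raise X) (raise Y) x y = P.Rel k X Y x y
  Rel k uni       (raise _) _ _ = ⊥
  Rel k (raise _) uni       _ _ = ⊥

  eq-refl : ∀ X → Eq X X
  eq-refl uni       = tt
  eq-refl (raise X) = P.eq-refl X

  eq-sym : ∀ X Y → Eq X Y → Eq Y X
  eq-sym uni       uni       = λ _ → tt
  eq-sym (raise X) (raise Y) = P.eq-sym X Y

  eq-trans : ∀ X Y Z → Eq X Y → Eq Y Z → Eq X Z
  eq-trans uni       uni       uni       = λ _ _ → tt
  eq-trans (raise X) (raise Y) (raise Z) = P.eq-trans X Y Z

  rel-refl : ∀ k X x → Rel k X X x x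
  rel-refl k uni       X = λ _ → P.eq-refl X
  rel-refl k (raise X) x = P.rel-refl k X x

  rel-resp : ∀ k X X′ Y Y′ → Eq X X′ → Eq Y Y′ → ∀ x x′ y y′ →
             Rel ∞ X X′ x x′ → Rel ∞ Y Y′ y y′ →
             Rel k X Y x y → Rel k X′ Y′ x′ y′
  rel-resp k uni uni uni uni _ _ X X′ Y Y′ r s t n≺k =
    P.eq-trans X′ X Y′ (P.eq-sym X X′ (r tt))
      (P.eq-trans X Y Y′ (t n≺k) (s tt))
  rel-resp k (raise X) (raise X′) (raise Y) (raise Y′) = P.rel-resp k X X′ Y Y′
  rel-resp k uni uni (raise _) (raise _) _ _ _ _ _ _ _ _ ()
  rel-resp k (raise _) (raise _) uni uni _ _ _ _ _ _ _ _ ()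

  cast : ∀ X Y → Eq X Y → El X → El Y
  cast uni       uni       _ X = X
  cast (raise X) (raise Y) e x = P.cast X Y e x

  cast-rel : ∀ X Y (e : Eq X Y) x → Rel ∞ X Y x (cast X Y e x)
  cast-rel uni       uni       _ X = λ _ → P.eq-refl X
  cast-rel (raise X) (raise Y) e x = P.cast-rel X Y e x

  successor : Universe
  successor = record
    { Code = SucCode P.Code ; El = El ; Eq = Eq ; Rel = Rel
    ; eq-refl = eq-refl ; eq-sym = eq-sym ; eq-trans = eq-trans
    ; rel-refl = rel-refl ; rel-resp = rel-resp
    ; cast = cast ; cast-rel = cast-rel
    }

  -- For `uni` the guard `n ≺ k` is met by `n<k`, so the relation is already equality of codes;
  -- raised codes inherit discreteness from `P`.
  successor-discrete : ∀ k → suc n ≤ k → P.Discrete (fin k) →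
                       Universe.Discrete successor (fin k)
  successor-discrete k n<k d uni       uni       _ X Y r = λ _ → r n<k
  successor-discrete k n<k d (raise X) (raise Y) = d X Y

open Successor using (successor; successor-discrete)

generators : ℕ → Universe
generators zero    = ground
generators (suc n) = successor n (closure (generators n))

-- Opacity makes Code, El, Eq and Rel below injective for unification.
opaque
  𝓤 : ℕ → Universe
  𝓤 n = closure (generators n)

module Level (n : ℕ) = Universe (𝓤 n)
open Level renaming (El to Elᶜ)

opaque
  unfolding 𝓤

  -- Induction on the level. The one new generator of level `suc n` is the universe of level `n`,
  -- which is discrete from index `suc n` on; closing under Π preserves discreteness.
  discrete : ∀ n k → n ≤ k → Discrete n (fin k)
  discrete zero    k _   = closure-discrete ground (fin k)
    λ { bool bool _ x y r → r }
  discrete (suc n) k n<k = closure-discrete (generators (suc n)) (fin k)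
    (successor-discrete n (𝓤 n) k n<k
      (discrete n k (≤-trans (n≤1+n n) n<k)))

  ⊥ᶜ : Code 0
  ⊥ᶜ = base empty

  ⊥ᶜ-elim : Elᶜ 0 ⊥ᶜ → ⊥
  ⊥ᶜ-elim x = x

  Boolᶜ : Code 0
  Boolᶜ = base bool

  fromBool : Bool → Elᶜ 0 Boolᶜ
  fromBool b = b

  fromBool-injective : ∀ {b b′} →
    Rel 0 ∞ Boolᶜ Boolᶜ (fromBool b) (fromBool b′) → b ≡ b′
  fromBool-injective r = r

  Uᶜ : ∀ n → Code (suc n)
  Uᶜ n = base uni

  -- Vacuous, since the guard reads `n < n`. The index `n` is the crucial one: the universe of level
  -- `n` is still indiscrete there, while by `discrete` every type of level `n` is already discrete.
  Uᶜ-indiscrete : ∀ n X Y → Rel (suc n) (fin n) (Uᶜ n) (Uᶜ n) X Y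
  Uᶜ-indiscrete n X Y n<n = ⊥-elim (<-irrefl refl n<n)

  -- Identities where `𝓤` is unfolded; elsewhere codes and elements of the universe are exchanged
  -- through this pair.
  encode : ∀ n → Code n → Elᶜ (suc n) (Uᶜ n)
  encode n X = X

  decode : ∀ n → Elᶜ (suc n) (Uᶜ n) → Code n
  decode n X = X

  encode-rel : ∀ n k X Y → (n ≺ k → Eq n X Y) →
               Rel (suc n) k (Uᶜ n) (Uᶜ n) (encode n X) (encode n Y)
  encode-rel n k X Y r = r

  decode-eq : ∀ n k X Y → Rel (suc n) k (Uᶜ n) (Uᶜ n) X Y → n ≺ k →
              Eq n (decode n X) (decode n Y)
  decode-eq n k X Y r = r

  decode-encode : ∀ n X → Eq n (decode n (encode n X)) X
  decode-encode = eq-refl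

  encode-decode : ∀ n X →
    Rel (suc n) ∞ (Uᶜ n) (Uᶜ n) (encode n (decode n X)) X
  encode-decode n X _ = eq-refl n X

-- Embeddings of lower levels into higher ones

record Embedding (m n : ℕ) : Set where
  field
    code     : Code m → Code n
    code-eq  : ∀ X Y → Eq m X Y → Eq n (code X) (code Y)
    to       : ∀ X → Elᶜ m X → Elᶜ n (code X)
    from     : ∀ X → Elᶜ n (code X) → Elᶜ m X
    to-rel   : ∀ k X Y x y → Rel m k X Y x y →
               Rel n k (code X) (code Y) (to X x) (to Y y)
    -- `from` has to preserve every index as well: functions between embedded codes are formed by
    -- composing with `from` on arguments and `to` on values.
    from-rel : ∀ k X Y x y → Rel n k (code X) (code Y) x y →
               Rel m k X Y (from X x) (from Y y)
    from-to  : ∀ X x → Rel m ∞ X X (from X (to X x)) x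
    to-from  : ∀ X x → Rel n ∞ (code X) (code X) (to X (from X x)) x

opaque
  unfolding 𝓤

  embed-suc : ∀ {m n} → Embedding m n → Embedding m (suc n)
  embed-suc E = record
    { code = λ X → base (raise (E.code X)) ; code-eq = E.code-eq
    ; to = E.to ; from = E.from
    ; to-rel = E.to-rel ; from-rel = E.from-rel
    ; from-to = E.from-to ; to-from = E.to-from
    }
    where module E = Embedding E

embed-refl : ∀ {n} → Embedding n n
embed-refl {n} = record
  { code = λ X → X ; code-eq = λ _ _ e → e
  ; to = λ _ x → x ; from = λ _ x → x
  ; to-rel = λ _ _ _ _ _ r → r ; from-rel = λ _ _ _ _ _ r → r
  ; from-to = rel-refl n ∞ ; to-from = rel-refl n ∞
  }

-- The order `≤′` grows its upper bound by one at a time, which matches one `raise` per level.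
embed : ∀ {m n} → m ≤′ n → Embedding m n
embed (≤′-reflexive refl) = embed-refl
embed (≤′-step m≤n)       = embed-suc (embed m≤n)

-- Π-codes within one level

Respectful : ∀ i j (A : Code i) → (Elᶜ i A → Code j) → Set
Respectful i j A B = ∀ a a′ → Rel i ∞ A A a a′ → Eq j (B a) (B a′)

opaque
  unfolding 𝓤

  πᶜ : ∀ n A (B : Elᶜ n A → Code n) → Respectful n n A B → Code n
  πᶜ n = π

  πᶜ-cong : ∀ n A B B-eq A′ B′ B′-eq → Eq n A A′ →
            (∀ a a′ → Rel n ∞ A A′ a a′ → Eq n (B a) (B′ a′)) →
            Eq n (πᶜ n A B B-eq) (πᶜ n A′ B′ B′-eq)
  πᶜ-cong n A B _ A′ B′ _ e h = e , h

  tabulate : ∀ n A B B-eq (f : ∀ a → Elᶜ n (B a)) →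
             (∀ k a a′ → Rel n k A A a a′ → Rel n k (B a) (B a′) (f a) (f a′)) →
             Elᶜ n (πᶜ n A B B-eq)
  tabulate n A B _ f f-rel = f , f-rel

  lookup : ∀ n A B B-eq → Elᶜ n (πᶜ n A B B-eq) → ∀ a → Elᶜ n (B a)
  lookup n A B _ = proj₁

  πᶜ-rel : ∀ n k A B B-eq A′ B′ B′-eq f f′ →
           (∀ a a′ → Rel n k A A′ a a′ →
            Rel n k (B a) (B′ a′) (lookup n A B B-eq f a) (lookup n A′ B′ B′-eq f′ a′)) →
           Rel n k (πᶜ n A B B-eq) (πᶜ n A′ B′ B′-eq) f f′
  πᶜ-rel n k A B _ A′ B′ _ f f′ r = r

  lookup-rel : ∀ n k A B B-eq A′ B′ B′-eq f f′ →
               Rel n k (πᶜ n A B B-eq) (πᶜ n A′ B′ B′-eq) f f′ →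
               ∀ a a′ → Rel n k A A′ a a′ →
               Rel n k (B a) (B′ a′) (lookup n A B B-eq f a) (lookup n A′ B′ B′-eq f′ a′)
  lookup-rel n k A B _ A′ B′ _ f f′ r = r

  -- The β-rule is definitional only while `𝓤` is unfolded; this makes it available outside.
  lookup-tabulate : ∀ n A B B-eq f f-rel a →
    lookup n A B B-eq (tabulate n A B B-eq f f-rel) a ≡ f a
  lookup-tabulate n A B _ f f-rel a = refl

-- Π-codes with domain and codomain of different levels

module Pi (i j : ℕ) where
  private
    n = i ⊔ j
    module I = Embedding (embed (≤⇒≤′ (m≤m⊔n i j)))
    module J = Embedding (embed (≤⇒≤′ (m≤n⊔m i j)))

    cod : ∀ A → (Elᶜ i A → Code j) → Elᶜ n (I.code A) → Code n
    cod A B a = J.code (B (I.from A a))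

    cod-eq : ∀ A B → Respectful i j A B → Respectful n n (I.code A) (cod A B)
    cod-eq A B B-eq a a′ r = J.code-eq _ _ (B-eq _ _ (I.from-rel ∞ A A a a′ r))

  opaque
    Πᶜ : ∀ A (B : Elᶜ i A → Code j) → Respectful i j A B → Code n
    Πᶜ A B B-eq = πᶜ n (I.code A) (cod A B) (cod-eq A B B-eq)

    Πᶜ-cong : ∀ A B B-eq A′ B′ B′-eq → Eq i A A′ →
              (∀ a a′ → Rel i ∞ A A′ a a′ → Eq j (B a) (B′ a′)) →
              Eq n (Πᶜ A B B-eq) (Πᶜ A′ B′ B′-eq)
    Πᶜ-cong A B _ A′ B′ _ e h = πᶜ-cong n _ _ _ _ _ _ (I.code-eq A A′ e)
      λ a a′ r → J.code-eq _ _ (h _ _ (I.from-rel ∞ A A′ a a′ r))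

    abs : ∀ A B B-eq (f : ∀ a → Elᶜ j (B a)) →
          (∀ k a a′ → Rel i k A A a a′ → Rel j k (B a) (B a′) (f a) (f a′)) →
          Elᶜ n (Πᶜ A B B-eq)
    abs A B B-eq f f-rel =
      tabulate n _ _ (cod-eq A B B-eq) (λ a → J.to _ (f (I.from A a)))
        λ k a a′ r → J.to-rel k _ _ _ _ (f-rel k _ _ (I.from-rel k A A a a′ r))

    private
      entry : ∀ A B B-eq → Elᶜ n (Πᶜ A B B-eq) → ∀ a → Elᶜ n (cod A B a)
      entry A B B-eq = lookup n _ _ (cod-eq A B B-eq)

      entry-abs : ∀ A B B-eq f f-rel a →
        Rel n ∞ (cod A B a) (cod A B a)
          (entry A B B-eq (abs A B B-eq f f-rel) a) (J.to _ (f (I.from A a)))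
      entry-abs A B B-eq f f-rel a
        rewrite lookup-tabulate n _ _ (cod-eq A B B-eq)
          (λ a → J.to _ (f (I.from A a)))
          (λ k a a′ r → J.to-rel k _ _ _ _ (f-rel k _ _ (I.from-rel k A A a a′ r))) a
        = rel-refl n ∞ _ _

    abs-rel : ∀ k A B B-eq f f-rel A′ B′ B′-eq f′ f′-rel →
              (∀ a a′ → Rel i k A A′ a a′ → Rel j k (B a) (B′ a′) (f a) (f′ a′)) →
              Rel n k (Πᶜ A B B-eq) (Πᶜ A′ B′ B′-eq)
                (abs A B B-eq f f-rel) (abs A′ B′ B′-eq f′ f′-rel)
    abs-rel k A B B-eq f f-rel A′ B′ B′-eq f′ f′-rel h =
      πᶜ-rel n k _ _ _ _ _ _ _ _ λ a a′ r →
        rel-resp n k _ _ _ _ (eq-refl n _) (eq-refl n _) _ _ _ _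
          (rel-sym n _ _ (eq-refl n _) _ _ (entry-abs A B B-eq f f-rel a))
          (rel-sym n _ _ (eq-refl n _) _ _ (entry-abs A′ B′ B′-eq f′ f′-rel a′))
          (J.to-rel k _ _ _ _ (h _ _ (I.from-rel k A A′ a a′ r)))

    private
      round : ∀ A B → Respectful i j A B →
              ∀ a → Eq j (B (I.from A (I.to A a))) (B a)
      round A B B-eq a = B-eq _ _ (I.from-to A a)

    -- The entry at the embedded argument belongs to the fibre over `I.from A (I.to A a)`, whence
    -- the final cast along `round`.
    ev : ∀ A B B-eq → Elᶜ n (Πᶜ A B B-eq) → ∀ a → Elᶜ j (B a)
    ev A B B-eq f a = cast j _ _ (round A B B-eq a)
      (J.from _ (entry A B B-eq f (I.to A a)))

    private
      ev-entry : ∀ A B B-eq f a →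
        Rel j ∞ (B a) (B (I.from A (I.to A a)))
          (ev A B B-eq f a) (J.from _ (entry A B B-eq f (I.to A a)))
      ev-entry A B B-eq f a =
        rel-sym j _ _ (round A B B-eq a) _ _ (cast-rel j _ _ (round A B B-eq a) _)

    ev-rel : ∀ k A B B-eq f A′ B′ B′-eq f′ →
             Rel n k (Πᶜ A B B-eq) (Πᶜ A′ B′ B′-eq) f f′ →
             ∀ a a′ → Rel i k A A′ a a′ →
             Rel j k (B a) (B′ a′) (ev A B B-eq f a) (ev A′ B′ B′-eq f′ a′)
    ev-rel k A B B-eq f A′ B′ B′-eq f′ r a a′ s =
      rel-resp j k _ _ _ _ (round A B B-eq a) (round A′ B′ B′-eq a′) _ _ _ _
        (cast-rel j _ _ (round A B B-eq a) _)
        (cast-rel j _ _ (round A′ B′ B′-eq a′) _)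
        (J.from-rel k _ _ _ _
          (lookup-rel n k _ _ _ _ _ _ f f′ r _ _ (I.to-rel k A A′ a a′ s)))

    ev-abs : ∀ A B B-eq f f-rel a →
             Rel j ∞ (B a) (B a) (ev A B B-eq (abs A B B-eq f f-rel) a) (f a)
    ev-abs A B B-eq f f-rel a =
      -- From the innermost step outwards: drop the cast in `ev`, compute the entry of `abs`, cancel
      -- the codomain embedding, and cancel the domain embedding under `f`.
      rel-respʳ j ∞ _ _ _ (round A B B-eq a) _ _ _ (f-rel ∞ _ _ (I.from-to A a))
        (rel-respʳ j ∞ _ _ _ (eq-refl j _) _ _ _ (J.from-to _ _)
          (rel-respʳ j ∞ _ _ _ (eq-refl j _) _ _ _
            (J.from-rel ∞ _ _ _ _ (entry-abs A B B-eq f f-rel _))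
            (ev-entry A B B-eq (abs A B B-eq f f-rel) a)))

    abs-ev : ∀ A B B-eq f f-rel →
             Rel n ∞ (Πᶜ A B B-eq) (Πᶜ A B B-eq)
               (abs A B B-eq (ev A B B-eq f) f-rel) f
    abs-ev A B B-eq f f-rel = πᶜ-rel n ∞ _ _ _ _ _ _ _ _ λ a a′ r →
      let e   = round A B B-eq (I.from A a)
          f-∞ = lookup-rel n ∞ _ _ _ _ _ _ f f (rel-refl n ∞ _ f)
      -- From the innermost step outwards: compute the entry of `abs`, drop the cast in `ev`, cancel
      -- the codomain embedding, cancel the domain embedding under `f`, and pass from `a` to `a′`.
      in rel-respʳ n ∞ _ _ _ (cod-eq A B B-eq a a′ r) _ _ _ (f-∞ a a′ r)
        (rel-respʳ n ∞ _ _ _ (J.code-eq _ _ e) _ _ _ (f-∞ _ _ (I.to-from A a))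
          (rel-respʳ n ∞ _ _ _ (eq-refl n _) _ _ _ (J.to-from _ _)
            (rel-respʳ n ∞ _ _ _ (J.code-eq _ _ (eq-sym j _ _ e)) _ _ _
              (J.to-rel ∞ _ _ _ _ (ev-entry A B B-eq f _))
              (entry-abs A B B-eq (ev A B B-eq f) f-rel a))))

-- The category with families

record Context : Set₁ where
  field
    Carrier : Set
    _∼[_]_  : Carrier → Index → Carrier → Set
    ∼-refl  : ∀ k x → x ∼[ k ] x
    ∼-sym   : ∀ x y → x ∼[ ∞ ] y → y ∼[ ∞ ] x
    ∼-trans : ∀ x y z → x ∼[ ∞ ] y → y ∼[ ∞ ] z → x ∼[ ∞ ] z

open Context using (Carrier; ∼-refl; ∼-sym; ∼-trans)

_∋_∼[_]_ : (Γ : Context) → Carrier Γ → Index → Carrier Γ → Set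
_∋_∼[_]_ = Context._∼[_]_

record Subst (Δ Γ : Context) : Set where
  field
    fun     : Carrier Δ → Carrier Γ
    fun-rel : ∀ k x y → Δ ∋ x ∼[ k ] y → Γ ∋ fun x ∼[ k ] fun y

record _≈ˢ_ {Δ Γ} (σ τ : Subst Δ Γ) : Set where
  constructor ptˢ
  field at : ∀ x → Γ ∋ Subst.fun σ x ∼[ ∞ ] Subst.fun τ x

-- A type of level ℓ varies only along the relations with index above ℓ.
record Type (Γ : Context) (ℓ : ℕ) : Set where
  field
    code    : Carrier Γ → Code ℓ
    code-eq : ∀ k x y → Γ ∋ x ∼[ k ] y → ℓ ≺ k → Eq ℓ (code x) (code y)

record _≈ᵀ_ {Γ ℓ} (A B : Type Γ ℓ) : Set where
  constructor ptᵀ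
  field at : ∀ x → Eq ℓ (Type.code A x) (Type.code B x)

record Term (Γ : Context) {ℓ} (A : Type Γ ℓ) : Set where
  open Type A
  field
    fun     : ∀ x → Elᶜ ℓ (code x)
    fun-rel : ∀ k x y → Γ ∋ x ∼[ k ] y → Rel ℓ k (code x) (code y) (fun x) (fun y)

-- Equality of types is a separate field because `Rel ∞` does not entail equality of codes:
-- functions out of `empty` are vacuously related to functions out of `bool`.
record _≈ᵗ_ {Γ ℓ} {A B : Type Γ ℓ} (a : Term Γ A) (b : Term Γ B) : Set where
  constructor ptᵗ
  field
    types : A ≈ᵀ B
    at    : ∀ x → Rel ℓ ∞ (Type.code A x) (Type.code B x) (Term.fun a x) (Term.fun b x)

open _≈ˢ_ using () renaming (at to atˢ)
open _≈ᵀ_ using () renaming (at to atᵀ)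
open _≈ᵗ_ using (types) renaming (at to atᵗ)

idˢ : ∀ {Γ} → Subst Γ Γ
idˢ = record { fun = λ x → x ; fun-rel = λ _ _ _ r → r }

_∘ˢ_ : ∀ {Θ Δ Γ} → Subst Δ Γ → Subst Θ Δ → Subst Θ Γ
σ ∘ˢ τ = record
  { fun     = λ x → σ.fun (τ.fun x)
  ; fun-rel = λ k x y r → σ.fun-rel k _ _ (τ.fun-rel k x y r)
  }
  where
  module σ = Subst σ
  module τ = Subst τ

_[_]ᵀ : ∀ {Δ Γ ℓ} → Type Γ ℓ → Subst Δ Γ → Type Δ ℓ
A [ σ ]ᵀ = record
  { code    = λ x → A.code (σ.fun x)
  ; code-eq = λ k x y r → A.code-eq k _ _ (σ.fun-rel k x y r)
  }
  where
  module A = Type A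
  module σ = Subst σ

_[_]ᵗ : ∀ {Δ Γ ℓ} {A : Type Γ ℓ} → Term Γ A → (σ : Subst Δ Γ) → Term Δ (A [ σ ]ᵀ)
a [ σ ]ᵗ = record
  { fun     = λ x → a.fun (σ.fun x)
  ; fun-rel = λ k x y r → a.fun-rel k _ _ (σ.fun-rel k x y r)
  }
  where
  module a = Term a
  module σ = Subst σ

coeᵗ : ∀ {Γ ℓ} {A B : Type Γ ℓ} → A ≈ᵀ B → Term Γ A → Term Γ B
coeᵗ {ℓ = ℓ} e a = record
  { fun     = λ x → cast ℓ _ _ (atᵀ e x) (a.fun x)
  ; fun-rel = λ k x y r → rel-resp ℓ k _ _ _ _ (atᵀ e x) (atᵀ e y) _ _ _ _
      (cast-rel ℓ _ _ _ _) (cast-rel ℓ _ _ _ _) (a.fun-rel k x y r)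
  }
  where module a = Term a

≈ᵀ-refl : ∀ {Γ ℓ} {A : Type Γ ℓ} → A ≈ᵀ A
≈ᵀ-refl {ℓ = ℓ} = ptᵀ λ x → eq-refl ℓ _

≈ᵀ-sym : ∀ {Γ ℓ} {A B : Type Γ ℓ} → A ≈ᵀ B → B ≈ᵀ A
≈ᵀ-sym {ℓ = ℓ} e = ptᵀ λ x → eq-sym ℓ _ _ (atᵀ e x)

≈ᵀ-trans : ∀ {Γ ℓ} {A B C : Type Γ ℓ} → A ≈ᵀ B → B ≈ᵀ C → A ≈ᵀ C
≈ᵀ-trans {ℓ = ℓ} d e = ptᵀ λ x → eq-trans ℓ _ _ _ (atᵀ d x) (atᵀ e x)

≈ᵗ-refl : ∀ {Γ ℓ} {A : Type Γ ℓ} {a : Term Γ A} → a ≈ᵗ a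
≈ᵗ-refl {ℓ = ℓ} = ptᵗ ≈ᵀ-refl λ x → rel-refl ℓ ∞ _ _

[]ᵀ-cong : ∀ {Δ Γ ℓ} {A A′ : Type Γ ℓ} {σ σ′ : Subst Δ Γ} →
           A ≈ᵀ A′ → σ ≈ˢ σ′ → (A [ σ ]ᵀ) ≈ᵀ (A′ [ σ′ ]ᵀ)
[]ᵀ-cong {ℓ = ℓ} {A′ = A′} e s = ptᵀ λ x →
  -- Here `tt` proves `ℓ ≺ ∞`: types of every level respect the relation at ∞.
  eq-trans ℓ _ _ _ (atᵀ e _) (Type.code-eq A′ ∞ _ _ (atˢ s x) tt)

_▷ᶜ_ : ∀ Γ {ℓ} → Type Γ ℓ → Context
_▷ᶜ_ Γ {ℓ} A = record
  { Carrier = Σ (Carrier Γ) λ x → Elᶜ ℓ (A.code x)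
  ; _∼[_]_  = λ (x , a) k (y , b) → Γ ∋ x ∼[ k ] y × Rel ℓ k (A.code x) (A.code y) a b
  ; ∼-refl  = λ k (x , a) → ∼-refl Γ k x , rel-refl ℓ k _ a
  ; ∼-sym   = λ (x , a) (y , b) (r , s) →
      ∼-sym Γ x y r , rel-sym ℓ _ _ (A.code-eq ∞ x y r tt) a b s
  ; ∼-trans = λ (x , a) (y , b) (z , c) (r , s) (r′ , s′) →
      ∼-trans Γ x y z r r′ ,
      rel-respʳ ℓ ∞ _ _ _ (A.code-eq ∞ y z r′ tt) a b c s′ s
  }
  where module A = Type A

cwf : CwF _ _ _ _ _
cwf = record
  { Con  = Context
  ; Sub  = Subst
  ; _≈ˢ_ = _≈ˢ_
  ; ≈ˢ-isEquivalence = λ {Δ} {Γ} → record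
      { refl  = ptˢ λ x → ∼-refl Γ ∞ _
      ; sym   = λ e → ptˢ λ x → ∼-sym Γ _ _ (atˢ e x)
      ; trans = λ d e → ptˢ λ x → ∼-trans Γ _ _ _ (atˢ d x) (atˢ e x)
      }
  ; id  = idˢ
  ; _∘_ = _∘ˢ_
  ; ∘-cong = λ {_} {_} {Γ} {σ} {σ′} {τ} {τ′} d e → ptˢ λ x →
      ∼-trans Γ _ _ _ (Subst.fun-rel σ ∞ _ _ (atˢ e x)) (atˢ d _)
  ; ∘-assoc     = λ {_} {_} {_} {Γ} _ _ _ → ptˢ λ x → ∼-refl Γ ∞ _
  ; ∘-identityˡ = λ {_} {Γ} _ → ptˢ λ x → ∼-refl Γ ∞ _
  ; ∘-identityʳ = λ {_} {Γ} _ → ptˢ λ x → ∼-refl Γ ∞ _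
  ; ◇ = record
      { Carrier = ⊤ ; _∼[_]_ = λ _ _ _ → ⊤
      ; ∼-refl = λ _ _ → tt ; ∼-sym = λ _ _ _ → tt ; ∼-trans = λ _ _ _ _ _ → tt }
  ; ! = record { fun = λ _ → tt ; fun-rel = λ _ _ _ _ → tt }
  ; !-unique = λ _ → ptˢ λ _ → tt
  ; Ty   = Type
  ; _≈ᵀ_ = _≈ᵀ_
  ; ≈ᵀ-isEquivalence = record { refl = ≈ᵀ-refl ; sym = ≈ᵀ-sym ; trans = ≈ᵀ-trans }
  ; _[_]ᵀ = _[_]ᵀ
  ; []ᵀ-cong = []ᵀ-cong
  ; []ᵀ-id = λ _ → ≈ᵀ-refl
  ; []ᵀ-∘  = λ _ _ _ → ≈ᵀ-refl
  ; Tm = Term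
  ; _≈ᵗ_ = _≈ᵗ_
  ; ≈ᵗ-refl  = ≈ᵗ-refl
  ; ≈ᵗ-sym   = λ {_} {ℓ} e → ptᵗ (≈ᵀ-sym (types e)) λ x →
      rel-sym ℓ _ _ (atᵀ (types e) x) _ _ (atᵗ e x)
  ; ≈ᵗ-trans = λ {_} {ℓ} d e → ptᵗ (≈ᵀ-trans (types d) (types e)) λ x →
      rel-respʳ ℓ ∞ _ _ _ (atᵀ (types e) x) _ _ _ (atᵗ e x) (atᵗ d x)
  ; ≈ᵗ⇒≈ᵀ = types
  ; coe = coeᵗ
  ; coe-≈ = λ {_} {ℓ} e a → ptᵗ (≈ᵀ-sym e) λ x →
      rel-sym ℓ _ _ (atᵀ e x) _ _ (cast-rel ℓ _ _ _ _)
  ; _[_]ᵗ = _[_]ᵗ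
  ; []ᵗ-cong = λ {_} {_} {ℓ} {_} {A′} {_} {a′} e s →
      ptᵗ ([]ᵀ-cong (types e) s) λ x →
        rel-respʳ ℓ ∞ _ _ _ (Type.code-eq A′ ∞ _ _ (atˢ s x) tt) _ _ _
          (Term.fun-rel a′ ∞ _ _ (atˢ s x)) (atᵗ e _)
  ; []ᵗ-id = λ _ → ≈ᵗ-refl
  ; []ᵗ-∘  = λ _ _ _ → ≈ᵗ-refl
  ; _▷_ = _▷ᶜ_
  ; p = record { fun = proj₁ ; fun-rel = λ _ _ _ → proj₁ }
  ; q = record { fun = proj₂ ; fun-rel = λ _ _ _ → proj₂ }
  ; ⟨_,_⟩ = λ σ a → record
      { fun     = λ x → Subst.fun σ x , Term.fun a x
      ; fun-rel = λ k x y r → Subst.fun-rel σ k x y r , Term.fun-rel a k x y r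
      }
  ; p-⟨⟩ = λ {_} {Γ} _ _ → ptˢ λ x → ∼-refl Γ ∞ _
  ; q-⟨⟩ = λ _ _ → ≈ᵗ-refl
  ; ⟨⟩-unique = λ _ d e → ptˢ λ x → atˢ d x , atᵗ e x
  }

open CwF cwf using (▷-coe)

-- Π-types of the model

module _ {Γ : Context} {i j : ℕ} where
  open Pi i j

  private
    module Fibre (A : Type Γ i) (B : Type (Γ ▷ᶜ A) j) (x : Carrier Γ) where
      cod : Elᶜ i (Type.code A x) → Code j
      cod a = Type.code B (x , a)

      cod-eq : Respectful i j (Type.code A x) cod
      cod-eq a a′ r = Type.code-eq B ∞ _ _ (∼-refl Γ ∞ x , r) tt

  Πᵀ : (A : Type Γ i) → Type (Γ ▷ᶜ A) j → Type Γ (i ⊔ j)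
  Πᵀ A B = record
    { code    = λ x → Πᶜ (A.code x) (F.cod x) (F.cod-eq x)
    ; code-eq = λ k x y r n≺k →
        -- An index above `i ⊔ j` is above both levels, so domain and codomain may both vary along
        -- it. For the codomain, `s` is first weakened from ∞ to `k`.
        let e = A.code-eq k x y r (≤-≺-trans k (m≤m⊔n i j) n≺k)
        in Πᶜ-cong _ _ _ _ _ _ e λ a a′ s →
             B.code-eq k _ _ (r , ∞⇒rel i k _ _ e a a′ s)
               (≤-≺-trans k (m≤n⊔m i j) n≺k)
    }
    where
    module A = Type A
    module B = Type B
    module F = Fibre A B

  lamᵗ : {A : Type Γ i} {B : Type (Γ ▷ᶜ A) j} → Term (Γ ▷ᶜ A) B → Term Γ (Πᵀ A B)
  lamᵗ {A} {B} b = record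
    { fun     = λ x → abs _ (F.cod x) (F.cod-eq x) (λ a → b.fun (x , a))
        λ k a a′ r → b.fun-rel k _ _ (∼-refl Γ k x , r)
    ; fun-rel = λ k x y r → abs-rel k _ _ _ _ _ _ _ _ _ _
        λ a a′ s → b.fun-rel k _ _ (r , s)
    }
    where
    module b = Term b
    module F = Fibre A B

  appᵗ : {A : Type Γ i} {B : Type (Γ ▷ᶜ A) j} → Term Γ (Πᵀ A B) → Term (Γ ▷ᶜ A) B
  appᵗ {A} {B} f = record
    { fun     = λ (x , a) → ev _ (F.cod x) (F.cod-eq x) (f.fun x) a
    ; fun-rel = λ k (x , a) (y , a′) (r , s) →
        ev-rel k _ _ _ _ _ _ _ _ (f.fun-rel k x y r) a a′ s
    }
    where
    module f = Term f
    module F = Fibre A B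

Πᵀ-cong : ∀ {Γ i j} {A A′ : Type Γ i} {B : Type (Γ ▷ᶜ A) j} {B′ : Type (Γ ▷ᶜ A′) j} →
          (e : A ≈ᵀ A′) → B ≈ᵀ (B′ [ ▷-coe e ]ᵀ) → Πᵀ A B ≈ᵀ Πᵀ A′ B′
Πᵀ-cong {Γ} {i} {j} {B′ = B′} e h = ptᵀ λ x →
  Pi.Πᶜ-cong i j _ _ _ _ _ _ (atᵀ e x) λ a a′ r →
    eq-trans j _ _ _ (atᵀ h (x , a))
      -- `▷-coe e` sends `(x , a)` to `x` paired with the cast of `a`, which is related to `a′`
      -- because `a` is.
      (Type.code-eq B′ ∞ _ _
        (∼-refl Γ ∞ x ,
         rel-respˡ i ∞ _ _ _ (atᵀ e x) _ _ _ (cast-rel i _ _ _ _) r) tt)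

Πᵀ-[] : ∀ {Δ Γ i j} (A : Type Γ i) (B : Type (Γ ▷ᶜ A) j) (σ : Subst Δ Γ) →
        (Πᵀ A B [ σ ]ᵀ) ≈ᵀ Πᵀ (A [ σ ]ᵀ) (B [ CwF._↑_ cwf σ A ]ᵀ)
Πᵀ-[] {Γ = Γ} {i} {j} A B σ = ptᵀ λ x →
  Pi.Πᶜ-cong i j _ _ _ _ _ _ (eq-refl i _) λ a a′ r →
    Type.code-eq B ∞ _ _
      (∼-refl Γ ∞ _ ,
       rel-respʳ i ∞ _ _ _ (eq-refl i _) _ _ _ (cast-rel i _ _ _ _) r) tt

hasΠ : HasΠ cwf
hasΠ = record
  { Π = Πᵀ
  ; Π-cong = λ {_} {_} {_} {A} {A′} {B} {B′} → Πᵀ-cong {A = A} {A′} {B} {B′}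
  ; Π-[] = Πᵀ-[]
  ; lam = λ {_} {_} {_} {A} {B} → lamᵗ {A = A} {B}
  ; lam-cong = λ {Γ} {i} {j} {A} {A′} {B} {B′} {b} {b′} e h →
      ptᵗ (Πᵀ-cong {A = A} {A′} {B} {B′} e (types h)) λ x →
        Pi.abs-rel i j ∞ _ _ _ _ _ _ _ _ _ _ λ a a′ r →
          let s = ∼-refl Γ ∞ x ,
                  rel-respˡ i ∞ _ _ _ (atᵀ e x) _ _ _ (cast-rel i _ _ _ _) r
          in rel-respʳ j ∞ _ _ _ (Type.code-eq B′ ∞ _ _ s tt) _ _ _
               (Term.fun-rel b′ ∞ _ _ s) (atᵗ h (x , a))
  ; lam-[] = λ {Δ} {Γ} {i} {j} {A} {B} b σ →
      ptᵗ (Πᵀ-[] A B σ) λ x →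
        Pi.abs-rel i j ∞ _ _ _ _ _ _ _ _ _ _ λ a a′ r →
          Term.fun-rel b ∞ _ _
            (∼-refl Γ ∞ _ ,
             rel-respʳ i ∞ _ _ _ (eq-refl i _) _ _ _ (cast-rel i _ _ _ _) r)
  ; app = λ {_} {_} {_} {A} {B} → appᵗ {A = A} {B}
  ; app-cong = λ {Γ} {i} {j} e h r → ptᵗ h λ (x , a) →
      Pi.ev-rel i j ∞ _ _ _ _ _ _ _ _ (atᵗ r x) _ _ (cast-rel i _ _ _ _)
  ; Π-β = λ {Γ} {i} {j} b → ptᵗ ≈ᵀ-refl λ (x , a) → Pi.ev-abs i j _ _ _ _ _ a
  ; Π-η = λ {Γ} {i} {j} f → ptᵗ ≈ᵀ-refl λ x → Pi.abs-ev i j _ _ _ _ _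
  }

-- Universes of the model

hasUniverses : HasUniverses cwf
hasUniverses = record
  { U       = λ ℓ → record { code = λ _ → Uᶜ ℓ ; code-eq = λ _ _ _ _ _ → eq-refl (suc ℓ) _ }
  ; U-[]    = λ _ _ → ≈ᵀ-refl
  -- The guard `ℓ ≺ k` in `code-eq` of `Type` is also the guard in `Rel k` on `Uᶜ ℓ`, so terms of
  -- `U ℓ` and types of level `ℓ` carry the same data.
  ; El      = λ {_} {ℓ} X → record
      { code    = λ x → decode ℓ (Term.fun X x)
      ; code-eq = λ k x y r → decode-eq ℓ k _ _ (Term.fun-rel X k x y r)
      }
  ; El-cong = λ {_} {ℓ} e → ptᵀ λ x → decode-eq ℓ ∞ _ _ (atᵗ e x) tt
  ; El-[]   = λ {_} {_} {ℓ} X σ → ptᵀ λ x →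
      decode-eq ℓ ∞ _ _ (cast-rel (suc ℓ) _ _ _ _) tt
  ; code    = λ {_} {ℓ} A → record
      { fun     = λ x → encode ℓ (Type.code A x)
      ; fun-rel = λ k x y r → encode-rel ℓ k _ _ (Type.code-eq A k x y r)
      }
  ; code-cong = λ {_} {ℓ} e → ptᵗ ≈ᵀ-refl λ x → encode-rel ℓ ∞ _ _ λ _ → atᵀ e x
  ; El-code = λ {_} {ℓ} A → ptᵀ λ x → decode-encode ℓ _
  ; code-El = λ {_} {ℓ} X → ptᵗ ≈ᵀ-refl λ x → encode-decode ℓ _
  }

-- Lifting

private
  module Raise {ℓ} = Embedding (embed-suc (embed-refl {ℓ}))

Liftᵀ : ∀ {Γ ℓ} → Type Γ ℓ → Type Γ (suc ℓ)
Liftᵀ {ℓ = ℓ} A = record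
  { code    = λ x → Raise.code (A.code x)
  ; code-eq = λ k x y r n<k → Raise.code-eq _ _
      (A.code-eq k x y r (≤-≺-trans k (n≤1+n ℓ) n<k))
  }
  where module A = Type A

Liftᵀ-cong : ∀ {Γ ℓ} {A B : Type Γ ℓ} → A ≈ᵀ B → Liftᵀ A ≈ᵀ Liftᵀ B
Liftᵀ-cong e = ptᵀ λ x → Raise.code-eq _ _ (atᵀ e x)

hasLift : HasLift cwf
hasLift = record
  { Lift      = Liftᵀ
  ; Lift-cong = Liftᵀ-cong
  ; Lift-[]   = λ _ _ → ≈ᵀ-refl
  ; lift      = λ a → record
      { fun     = λ x → Raise.to _ (Term.fun a x)
      ; fun-rel = λ k x y r → Raise.to-rel k _ _ _ _ (Term.fun-rel a k x y r)
      }
  ; lift-cong = λ e → ptᵗ (Liftᵀ-cong (types e)) λ x →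
      Raise.to-rel ∞ _ _ _ _ (atᵗ e x)
  ; lift-[]   = λ _ _ → ≈ᵗ-refl
  ; lower     = λ a → record
      { fun     = λ x → Raise.from _ (Term.fun a x)
      ; fun-rel = λ k x y r → Raise.from-rel k _ _ _ _ (Term.fun-rel a k x y r)
      }
  ; lower-cong = λ e d → ptᵗ e λ x → Raise.from-rel ∞ _ _ _ _ (atᵗ d x)
  ; lower-lift = λ a → ptᵗ ≈ᵀ-refl λ x → Raise.from-to _ _
  ; lift-lower = λ a → ptᵗ ≈ᵀ-refl λ x → Raise.to-from _ _
  }

-- The model, its non-triviality and the constancy of functions on universes

model : Model _ _ _ _ _
model = record
  { cwf = cwf ; hasΠ = hasΠ ; hasUniverses = hasUniverses ; hasLift = hasLift }

constantᵀ : ∀ {Γ ℓ} → Code ℓ → Type Γ ℓ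
constantᵀ {ℓ = ℓ} X = record
  { code = λ _ → X ; code-eq = λ _ _ _ _ _ → eq-refl ℓ X }

constantᵗ : ∀ {Γ ℓ} {X : Code ℓ} → Elᶜ ℓ X → Term Γ (constantᵀ X)
constantᵗ {ℓ = ℓ} x = record
  { fun = λ _ → x ; fun-rel = λ k _ _ _ → rel-refl ℓ k _ x }

nonTrivial : NonTrivial model
nonTrivial =
  (constantᵀ ⊥ᶜ , λ t → ⊥ᶜ-elim (Term.fun t tt)) ,
  (constantᵀ Boolᶜ , constantᵗ (fromBool true) , constantᵗ (fromBool false) ,
   λ e → case fromBool-injective (atᵗ e tt) of λ ())

mainTheorem1 : ∃Model λ M → let open Model M in
    NonTrivial M ×
    (∀ {Γ : Con} (ℓ : ℕ) (A : Tm Γ (U ℓ)) (f : Tm Γ (U ℓ ⇒ El A)) →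
    IsConstant M A f)
mainTheorem1 = exhibit model
  ( nonTrivial
  , λ ℓ A f X Y → ptᵗ ≈ᵀ-refl λ x →
      -- Everything happens at index `fin ℓ`: the value of `f` at `x` is related to itself there,
      -- hence sends related codes to related elements, and `discrete` turns these into equal ones.
      -- `Uᶜ-indiscrete` holds for arbitrary elements, so the casts inside `inst` do no harm.
      discrete ℓ ℓ ≤-refl _ _ (eq-refl ℓ _) _ _
        (Pi.ev-rel (suc ℓ) ℓ (fin ℓ) _ _ _ _ _ _ _ _
          (rel-refl (suc ℓ ⊔ ℓ) (fin ℓ) _ (Term.fun f x)) _ _
          (Uᶜ-indiscrete ℓ _ _))
  )
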